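{- For every positive integer $n$ there is a bijection $\varphi:\mathcal{C}_{n+1}\to\mathcal{S}_n$ such that if $\pi\in\mathcal{C}_{n+1}$ and $\sigma=\varphi(\pi)$, then $$D(\pi)\cap[n-1]=D(\sigma).$$
   Context: $[n]=\{1,2,\dots,n\}$; $\mathcal{S}_n$ is the set of permutations of $[n]$; $\mathcal{C}_n\subseteq\mathcal{S}_n$ is the set of permutations consisting of one single cycle of length $n$. For $\pi\in\mathcal{S}_n$, the descent set is $D(\pi)=\{i : 1\le i\le n-1,\ \pi(i)>\pi(i+1)\}$. -}

module Defs where

open import Data.Fin.Base as Fin using (Fin; toℕ; fromℕ; inject₁)
open import Data.Fin.Permutation using (Permutation′; _⟨$⟩ʳ_; _≈_)
open import Data.Nat.Base using (ℕ; zero; suc; _≤_; NonZero)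
open import Data.Product.Base using (∃; ∃₂; _×_; proj₁)
open import Level using (0ℓ)
open import Relation.Binary.Bundles using (Setoid)
import Relation.Binary.Construct.On as On
open import Relation.Binary.PropositionalEquality using (_≡_; refl; sym; trans)
open import Relation.Unary using (Pred)

-- [ n ] = {1, …, n} as a set of natural numbers.  Permutations of it are
-- the library's permutations of Fin n, where x : Fin n stands for the
-- number label x.

[_] : ℕ → Pred ℕ 0ℓ
[ n ] i = 1 ≤ i × i ≤ n

label : ∀ {n} → Fin n → ℕ
label x = suc (toℕ x)

-- Without function extensionality, equality of permutations has to be
-- taken pointwise, hence setoids rather than types.

𝒮 : ℕ → Setoid 0ℓ 0ℓ
𝒮 n = record
  { Carrier       = Permutation′ n
  ; _≈_           = _≈_
  ; isEquivalence = record
    { refl  = λ _ → refl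
    ; sym   = λ p i → sym (p i)
    ; trans = λ p q i → trans (p i) (q i)
    }
  }

-- π is written (c₀ c₁ … cₙ) in cycle notation, where c lists every
-- element of the underlying set exactly once.

record IsFullCycle {n : ℕ} (π : Permutation′ (suc n)) : Set where
  field
    c     : Permutation′ (suc n)
    step  : ∀ (k : Fin n) → π ⟨$⟩ʳ (c ⟨$⟩ʳ inject₁ k) ≡ c ⟨$⟩ʳ Fin.suc k
    close : π ⟨$⟩ʳ (c ⟨$⟩ʳ fromℕ n) ≡ c ⟨$⟩ʳ Fin.zero

-- Equality ignores the cycle notation witness (which is only determined
-- up to rotation), so 𝒞 n is a subset of 𝒮 n.

𝒞 : (n : ℕ) .{{_ : NonZero n}} → Setoid 0ℓ 0ℓ
𝒞 (suc n) = On.setoid {B = ∃ (IsFullCycle {n})} (𝒮 (suc n)) proj₁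

-- The range 1 ≤ i ≤ n − 1 is enforced by i and i + 1 both being labels
-- of elements of Fin n.

D : ∀ {n} → Permutation′ n → Pred ℕ 0ℓ
D {n} π i = ∃₂ λ (x y : Fin n) →
  label x ≡ i × label y ≡ suc i × (π ⟨$⟩ʳ x) Fin.> (π ⟨$⟩ʳ y)

{-# OPTIONS --safe #-}

-- Both sides are indexed by t ∈ 𝒮ₙ: the full cycles as (n+1 t₁ … tₙ), the permutations σ as
-- σ = t⁻¹.  Fix I ⊆ [n-1] and cut [n] into blocks after each element of I; call t and t′
-- equivalent if tⱼ and t′ⱼ always lie in the same block, i.e. if they spell the same word in the
-- block numbers.  Every class contains exactly one t with D(t⁻¹) ⊆ I (rank the positions by
-- letter, then by position) and exactly one t whose cycle has its descents below n in I (rank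
-- the positions lexicographically by the suffix of the word that starts there, as in the
-- Burrows–Wheeler or Gessel–Reutenauer correspondence).  So for every I both sides have equally
-- many elements with descent set inside I, hence by inclusion–exclusion equally many with any
-- given descent set, and the two sides can be matched up.

module Submission where

open import Defs
open import Data.Bool.Base using (true; false)
open import Data.Fin.Base as Fin
  using (Fin; zero; suc; toℕ; fromℕ; fromℕ<; inject₁; cast; punchIn)
open import Data.Fin.Induction using (<-weakInduction; >-weakInduction)
open import Data.Fin.Permutation as Perm
  using (Permutation′; permutation; _⟨$⟩ʳ_; _⟨$⟩ˡ_; _≈_; _∘ₚ_; flip; insert; remove; cast-id;
         inverseˡ; inverseʳ; insert-punchIn; insert-remove; remove-insert; punchIn-permute)
import Data.Fin.Properties as Fin
open import Data.Fin.Relation.Unary.Top using (view; ‵fromℕ; ‵inject₁)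
open import Data.Fin.Subset using (Subset; Side; inside; outside; _∈_; _∉_; _⊆_; ∣_∣)
open import Data.Fin.Subset.Properties
  using (_⊆?_; _∈?_; drop-there; p⊂q⇒∣p∣<∣q∣; ∣⊤∣≡n; ∈⊤)
open import Data.List.Base as List
  using (List; []; _∷_; _++_; length; filter; map; allFin; lookup; tabulate)
open import Data.List.Membership.Propositional using () renaming (_∈_ to _∈ˡ_)
open import Data.List.Membership.Propositional.Properties
  using (∈-lookup; ∈-allFin; ∈-filter⁺; ∈-filter⁻)
open import Data.List.Properties
  using (length-tabulate; lookup-tabulate; map-tabulate; tabulate-cong; ∷-injectiveˡ; ∷-injectiveʳ)
open import Data.List.Relation.Binary.Lex.Strict
  using (Lex-<; base; halt; this; next; xs≮[]; <-isStrictTotalOrder)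
open import Data.List.Relation.Binary.Permutation.Homogeneous using (onIndices)
open import Data.List.Relation.Binary.Permutation.Propositional
  using (_↭_; ↭-refl; ↭-reflexive; ↭-sym; ↭-trans; ↭-prep; ↭⇒↭ₛ)
open import Data.List.Relation.Binary.Permutation.Propositional.Properties using (shift; ++⁺; map⁺)
import Data.List.Relation.Binary.Permutation.Setoid.Properties as ↭ₛ
open import Data.List.Relation.Binary.Pointwise using (Pointwise; Pointwise-≡⇒≡; ≡⇒Pointwise-≡)
import Data.List.Relation.Unary.All as All
open import Data.List.Relation.Unary.AllPairs using (_∷_)
open import Data.List.Relation.Unary.Any using (index)
open import Data.List.Relation.Unary.Any.Properties using (lookup-index)
open import Data.List.Relation.Unary.Unique.Propositional using (Unique)
open import Data.List.Relation.Unary.Unique.Propositional.Properties using (allFin⁺; filter⁺)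
open import Data.Nat.Base
  using (ℕ; zero; suc; _+_; _*_; _∸_; _≤_; _<_; _>_; z≤n; s≤s; z<s; NonZero)
import Data.Nat.Properties as ℕ
open import Data.Product.Base using (Σ; ∃; _×_; _,_; proj₁; proj₂)
open import Data.Sum.Base using (inj₁; inj₂)
open import Data.Vec.Base as Vec using ([]; _∷_; here; there)
open import Data.Vec.Properties as Vec using ([]=⇒lookup; lookup⇒[]=; lookup∘tabulate)
open import Function.Base using (_∘_; id) renaming (flip to flip′)
open import Function.Bundles using (Bijection; Inverse; Injection)
open import Function.Construct.Composition using (inverse)
import Function.Construct.Symmetry as Symmetry
open import Function.Properties.Inverse using (Inverse⇒Bijection; ↔⇒↣)
open import Level using (0ℓ)
open import Relation.Binary.Core using (Rel)
import Relation.Binary.Construct.Flip.EqAndOrd as Flip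
open import Relation.Binary.Definitions using (tri<; tri≈; tri>)
open import Relation.Binary.PropositionalEquality hiding ([_])
open import Relation.Binary.Structures using (IsStrictTotalOrder)
open import Relation.Nullary using (¬_; Dec; does; yes; no; contradiction)
open import Relation.Nullary.Decidable using (dec-true)
open import Relation.Unary using (Pred; Decidable; _∩_; _≐_)
open import Relation.Unary.Properties using (≐-sym; ≐-trans)

private
  variable
    m n k : ℕ
    A X : Set

-- Inclusion–exclusion

below : Subset m → List (Subset m) → ℕ
below I L = length (filter (_⊆? I) L)

-- The recursion behind inclusion-exclusion: the family is split by membership of the first point,
-- multiplicities being kept.
tails : Side → List (Subset (suc m)) → List (Subset m)
tails _       []                  = []
tails inside  ((inside  ∷ p) ∷ L) = p ∷ tails inside L
tails inside  ((outside ∷ p) ∷ L) = tails inside L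
tails outside ((inside  ∷ p) ∷ L) = tails outside L
tails outside ((outside ∷ p) ∷ L) = p ∷ tails outside L

below-outside : ∀ (I : Subset m) L → below (outside ∷ I) L ≡ below I (tails outside L)
below-outside I []                  = refl
below-outside I ((inside  ∷ p) ∷ L) = below-outside I L
below-outside I ((outside ∷ p) ∷ L) with does (p ⊆? I)
... | true  = cong suc (below-outside I L)
... | false = below-outside I L

below-inside : ∀ (I : Subset m) L →
               below (inside ∷ I) L ≡ below I (tails outside L) + below I (tails inside L)
below-inside I []                  = refl
below-inside I ((inside  ∷ p) ∷ L) with does (p ⊆? I)
... | true  = trans (cong suc (below-inside I L)) (sym (ℕ.+-suc _ _))
... | false = below-inside I L
below-inside I ((outside ∷ p) ∷ L) with does (p ⊆? I)
... | true  = cong suc (below-inside I L)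
... | false = below-inside I L

tails-↭ : ∀ (L : List (Subset (suc m))) →
          L ↭ map (outside ∷_) (tails outside L) ++ map (inside ∷_) (tails inside L)
tails-↭ []                  = ↭-refl
tails-↭ ((inside  ∷ p) ∷ L) =
  ↭-trans (↭-prep _ (tails-↭ L)) (↭-sym (shift _ (map (outside ∷_) (tails outside L)) _))
tails-↭ ((outside ∷ p) ∷ L) = ↭-prep _ (tails-↭ L)

-- Möbius inversion on the Boolean lattice, one point at a time: forbidding the first point counts
-- one half of the list, allowing it counts both halves, and the other half follows by subtraction.
below-determines : ∀ (L L′ : List (Subset m)) → (∀ I → below I L ≡ below I L′) → L ↭ L′
below-determines {zero} L L′ eq = ↭-reflexive (length-determines L L′ (eq []))
  where
  length-determines : ∀ (K K′ : List (Subset 0)) → below [] K ≡ below [] K′ → K ≡ K′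
  length-determines []       []       _ = refl
  length-determines []       ([] ∷ _) ()
  length-determines ([] ∷ _) []       ()
  length-determines ([] ∷ K) ([] ∷ K′) e = cong ([] ∷_) (length-determines K K′ (ℕ.suc-injective e))
below-determines {suc m} L L′ eq = ↭-trans (tails-↭ L)
  (↭-trans (++⁺ (map⁺ _ (below-determines (tails outside L) (tails outside L′) outs))
                (map⁺ _ (below-determines (tails inside L) (tails inside L′) ins)))
           (↭-sym (tails-↭ L′)))
  where
  outs : ∀ I → below I (tails outside L) ≡ below I (tails outside L′)
  outs I = trans (sym (below-outside I L)) (trans (eq (outside ∷ I)) (below-outside I L′))

  ins : ∀ I → below I (tails inside L) ≡ below I (tails inside L′)
  ins I = ℕ.+-cancelˡ-≡ _ _ _ (begin
    below I (tails outside L′) + below I (tails inside L)  ≡⟨ cong (_+ _) (outs I) ⟨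
    below I (tails outside L)  + below I (tails inside L)  ≡⟨ below-inside I L ⟨
    below (inside ∷ I) L                                   ≡⟨ eq (inside ∷ I) ⟩
    below (inside ∷ I) L′                                  ≡⟨ below-inside I L′ ⟩
    below I (tails outside L′) + below I (tails inside L′) ∎)
    where open ≡-Reasoning

-- Finite matchings and an enumeration of permutations

-- A rearrangement of the values carries the indices along; the casts only identify positions in the
-- tabulated lists with elements of `Fin n`.
tabulate-↭⇒matching : (f g : Fin n → A) → tabulate f ↭ tabulate g →
                      ∃ λ (ρ : Permutation′ n) → ∀ i → g (ρ ⟨$⟩ʳ i) ≡ f i
tabulate-↭⇒matching {n} f g f↭g = ρ , matches
  where
  lf = length-tabulate f
  lg = length-tabulate g
  κ  = onIndices (↭⇒↭ₛ f↭g)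

  ρ : Permutation′ n
  ρ = cast-id (sym lf) ∘ₚ κ ∘ₚ cast-id lg

  matches : ∀ i → g (ρ ⟨$⟩ʳ i) ≡ f i
  matches i = begin
    g (cast lg i′)
      ≡⟨ lookup-tabulate g (cast lg i′) ⟨
    lookup (tabulate g) (cast (sym lg) (cast lg i′))
      ≡⟨ cong (lookup (tabulate g)) (Fin.cast-involutive (sym lg) lg i′) ⟩
    lookup (tabulate g) i′
      ≡⟨ ↭ₛ.onIndices-lookup (setoid _) (↭⇒↭ₛ f↭g) (cast (sym lf) i) ⟨
    lookup (tabulate f) (cast (sym lf) i)
      ≡⟨ lookup-tabulate f i ⟩
    f i ∎
    where
    open ≡-Reasoning
    i′ = κ ⟨$⟩ʳ cast (sym lf) i

lookup-injective : ∀ {xs : List A} → Unique xs → ∀ i j → lookup xs i ≡ lookup xs j → i ≡ j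
lookup-injective (x∉ ∷ u) zero    zero    eq = refl
lookup-injective (x∉ ∷ u) zero    (suc j) eq = contradiction eq (All.lookup x∉ (∈-lookup j))
lookup-injective (x∉ ∷ u) (suc i) zero    eq = contradiction (sym eq) (All.lookup x∉ (∈-lookup i))
lookup-injective (x∉ ∷ u) (suc i) (suc j) eq = cong suc (lookup-injective u i j eq)

-- Pigeonhole for a relation: choosing a partner for every entry gives a map of indices, injective
-- because entries with a common partner coincide and `xs` has no repetitions.
length-≤ : ∀ {xs ys : List A} {R : A → A → Set} → Unique xs →
           (∀ {x} → x ∈ˡ xs → ∃ λ y → y ∈ˡ ys × R x y) →
           (∀ {x x′ y} → x ∈ˡ xs → x′ ∈ˡ xs → R x y → R x′ y → x ≡ x′) →
           length xs ≤ length ys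
length-≤ {xs = xs} {ys} {R} u total inj = Fin.injective⇒≤ {f = image} λ {i} {j} eq →
  lookup-injective u i j (inj (∈-lookup i) (∈-lookup j) (related i)
    (subst (R (lookup xs j) ∘ lookup ys) (sym eq) (related j)))
  where
  image : Fin (length xs) → Fin (length ys)
  image i = index (proj₁ (proj₂ (total (∈-lookup i))))

  related : ∀ i → R (lookup xs i) (lookup ys (image i))
  related i with y , y∈ys , r ← total (∈-lookup {xs = xs} i) = subst (R _) (lookup-index y∈ys) r

length-filter-map : ∀ {P : Pred X 0ℓ} (P? : Decidable P) (f : A → X) xs →
                    length (filter P? (map f xs)) ≡ length (filter (P? ∘ f) xs)
length-filter-map P? f []       = refl
length-filter-map P? f (x ∷ xs) with does (P? (f x))
... | true  = cong suc (length-filter-map P? f xs)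
... | false = length-filter-map P? f xs

below-≤ : (f g : Fin n → Subset m) (I : Subset m) {R : Fin n → Fin n → Set} →
          (∀ x → f x ⊆ I → ∃ λ y → g y ⊆ I × R x y) →
          (∀ {x x′ y} → f x ⊆ I → f x′ ⊆ I → R x y → R x′ y → x ≡ x′) →
          below I (tabulate f) ≤ below I (tabulate g)
below-≤ {n} f g I total inj = subst₂ _≤_ (counts f) (counts g)
  (length-≤ (filter⁺ (λ i → f i ⊆? I) (allFin⁺ n))
    (λ {x} x∈ → let y , gy⊆I , r = total x (member x∈)
                in y , ∈-filter⁺ (λ i → g i ⊆? I) (∈-allFin y) gy⊆I , r)
    (λ {x} {x′} {y} x∈ x′∈ → inj {x} {x′} {y} (member x∈) (member x′∈)))
  where
  member : ∀ {x} → x ∈ˡ filter (λ i → f i ⊆? I) (allFin n) → f x ⊆ I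
  member x∈ = proj₂ (∈-filter⁻ (λ i → f i ⊆? I) {xs = allFin n} x∈)

  counts : ∀ (h : Fin n → Subset _) →
           length (filter (λ i → h i ⊆? I) (allFin n)) ≡ below I (tabulate h)
  counts h = trans (sym (length-filter-map (_⊆? I) h (allFin n)))
                   (cong (below I) (map-tabulate id h))

injective : ∀ (π : Permutation′ n) {i j} → π ⟨$⟩ʳ i ≡ π ⟨$⟩ʳ j → i ≡ j
injective π = Injection.injective (↔⇒↣ π)

flip-cong : {π ρ : Permutation′ n} → π ≈ ρ → flip π ≈ flip ρ
flip-cong {π = π} {ρ} π≈ρ i = injective ρ (begin
  ρ ⟨$⟩ʳ (π ⟨$⟩ˡ i) ≡⟨ π≈ρ _ ⟨
  π ⟨$⟩ʳ (π ⟨$⟩ˡ i) ≡⟨ inverseʳ π ⟩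
  i                 ≡⟨ inverseʳ ρ ⟨
  ρ ⟨$⟩ʳ (ρ ⟨$⟩ˡ i) ∎)
  where open ≡-Reasoning

remove-cong : ∀ i {π ρ : Permutation′ (suc n)} → π ≈ ρ → remove i π ≈ remove i ρ
remove-cong i {π} {ρ} π≈ρ j = Fin.punchIn-injective (π ⟨$⟩ʳ i) _ _ (begin
  punchIn (π ⟨$⟩ʳ i) (remove i π ⟨$⟩ʳ j) ≡⟨ punchIn-permute π i j ⟨
  π ⟨$⟩ʳ punchIn i j                     ≡⟨ π≈ρ _ ⟩
  ρ ⟨$⟩ʳ punchIn i j                     ≡⟨ punchIn-permute ρ i j ⟩
  punchIn (ρ ⟨$⟩ʳ i) (remove i ρ ⟨$⟩ʳ j) ≡⟨ cong (λ k → punchIn k (remove i ρ ⟨$⟩ʳ j)) (π≈ρ i) ⟨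
  punchIn (π ⟨$⟩ʳ i) (remove i ρ ⟨$⟩ʳ j) ∎)
  where open ≡-Reasoning

insert-self : ∀ i j (π : Permutation′ n) → insert i j π ⟨$⟩ʳ i ≡ j
insert-self i j π with i Fin.≟ i
... | yes _   = refl
... | no  i≢i = contradiction refl i≢i

insert-cong : ∀ i j {π ρ : Permutation′ n} → π ≈ ρ → insert i j π ≈ insert i j ρ
insert-cong i j {π} {ρ} π≈ρ k with i Fin.≟ k
... | yes _ = refl
... | no  _ = cong (punchIn j) (π≈ρ _)

-- A permutation is coded by the image of zero and by what is left after deleting zero, so `N` is n
-- factorial. Counting on `Fin N` then replaces counting on `𝒮 n`, whose equality is only pointwise.
enumeration : ∀ n → ∃ λ N → Inverse (𝒮 n) (setoid (Fin N))
enumeration zero = 1 , record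
  { to        = λ _ → zero
  ; from      = λ _ → Perm.id
  ; to-cong   = λ _ → refl
  ; from-cong = λ _ ()
  ; inverse   = (λ { {zero} _ → refl }) , λ _ ()
  }
enumeration (suc n) with N , enum ← enumeration n = suc n * N , record
  { to        = to
  ; from      = from
  ; to-cong   = λ {π} {ρ} → to-cong {π} {ρ}
  ; from-cong = λ { refl _ → refl }
  ; inverse   = (λ {x} {π} → inverse-to {x} {π}) , λ { {π} refl → from-to π }
  }
  where
  module E = Inverse enum
  module Q = Inverse (Fin.*↔× {suc n} {N})

  to : Permutation′ (suc n) → Fin (suc n * N)
  to π = Q.from (π ⟨$⟩ʳ zero , E.to (remove zero π))

  assemble : Fin (suc n) × Fin N → Permutation′ (suc n)
  assemble (a , b) = insert zero a (E.from b)

  from : Fin (suc n * N) → Permutation′ (suc n)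
  from x = assemble (Q.to x)

  to-cong : ∀ {π ρ} → π ≈ ρ → to π ≡ to ρ
  to-cong {π} {ρ} π≈ρ = cong₂ (λ a b → Q.from (a , b)) (π≈ρ zero)
    (E.to-cong {remove zero π} {remove zero ρ} (remove-cong zero {π} {ρ} π≈ρ))

  from-to : ∀ π → from (to π) ≈ π
  from-to π k = begin
    assemble (Q.to (to π)) ⟨$⟩ʳ k
      ≡⟨ cong (λ q → assemble q ⟨$⟩ʳ k) (Q.strictlyInverseˡ _) ⟩
    insert zero (π ⟨$⟩ʳ zero) (E.from (E.to (remove zero π))) ⟨$⟩ʳ k
      ≡⟨ insert-cong zero _ {E.from (E.to (remove zero π))} {remove zero π}
           (E.strictlyInverseʳ (remove zero π)) k ⟩
    insert zero (π ⟨$⟩ʳ zero) (remove zero π) ⟨$⟩ʳ k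
      ≡⟨ insert-remove zero π k ⟩
    π ⟨$⟩ʳ k ∎
    where open ≡-Reasoning

  inverse-to : ∀ {x π} → π ≈ from x → to π ≡ x
  inverse-to {x} {π} π≈ = begin
    to π                ≡⟨ to-cong {π} {from x} π≈ ⟩
    -- The image of zero under `from x` computes to `a`, so only the second component needs an
    -- argument.
    to (from x)         ≡⟨ cong (λ b → Q.from (a , b))
                             (E.inverseˡ {y = remove zero (from x)}
                               (remove-insert zero a (E.from b))) ⟩
    Q.from (Q.to x)     ≡⟨ Q.strictlyInverseʳ x ⟩
    x                   ∎
    where
    open ≡-Reasoning
    a = proj₁ (Q.to x)
    b = proj₂ (Q.to x)

-- Descents and blocks

∈-tabulate-does⁺ : {P : Fin n → Set} (P? : ∀ i → Dec (P i)) → ∀ {i} → P i →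
                   i ∈ Vec.tabulate (does ∘ P?)
∈-tabulate-does⁺ P? {i} p =
  lookup⇒[]= i _ (trans (lookup∘tabulate (does ∘ P?) i) (dec-true (P? i) p))

∈-tabulate-does⁻ : {P : Fin n → Set} (P? : ∀ i → Dec (P i)) → ∀ {i} →
                   i ∈ Vec.tabulate (does ∘ P?) → P i
∈-tabulate-does⁻ P? {i} i∈ with P? i | trans (sym (lookup∘tabulate (does ∘ P?) i)) ([]=⇒lookup i∈)
... | yes p | _ = p
... | no  _ | ()

descent? : (f : Fin (suc m) → Fin k) (i : Fin m) → Dec (f (suc i) Fin.< f (inject₁ i))
descent? f i = f (suc i) Fin.<? f (inject₁ i)

-- The codomain is free so that this also covers a cycle restricted to all points but the top one,
-- where the top may still occur as a value.
descents : (Fin (suc m) → Fin k) → Subset m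
descents f = Vec.tabulate (does ∘ descent? f)

descents-cong : {f g : Fin (suc m) → Fin k} → (∀ x → f x ≡ g x) → descents f ≡ descents g
descents-cong f≡g = Vec.tabulate-cong λ i →
  cong₂ (λ a b → does (a Fin.<? b)) (f≡g (suc i)) (f≡g (inject₁ i))

-- Counts the cuts to the left of a point; an element `i` of `I` cuts between `inject₁ i` and
-- `suc i`.
block : Subset m → Fin (suc m) → ℕ
block I             zero    = 0
block (inside  ∷ I) (suc x) = suc (block I x)
block (outside ∷ I) (suc x) = block I x

block-mono : ∀ (I : Subset m) {x y} → x Fin.≤ y → block I x ≤ block I y
block-mono I             {zero}          _         = z≤n
block-mono (inside  ∷ I) {suc x} {suc y} (s≤s x≤y) = s≤s (block-mono I x≤y)
block-mono (outside ∷ I) {suc x} {suc y} (s≤s x≤y) = block-mono I x≤y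

block-adjacent : ∀ (I : Subset m) {i} → i ∉ I → block I (inject₁ i) ≡ block I (suc i)
block-adjacent (inside  ∷ I) {zero}  i∉ = contradiction here i∉
block-adjacent (outside ∷ I) {zero}  i∉ = refl
block-adjacent (inside  ∷ I) {suc i} i∉ = cong suc (block-adjacent I (i∉ ∘ there))
block-adjacent (outside ∷ I) {suc i} i∉ = block-adjacent I (i∉ ∘ there)

inject₁<suc : ∀ (i : Fin n) → inject₁ i Fin.< suc i
inject₁<suc i = s≤s (ℕ.≤-reflexive (Fin.toℕ-inject₁ i))

IncreasingOnBlocks : Subset m → (Fin (suc m) → Fin k) → Set
IncreasingOnBlocks I f = ∀ x y → x Fin.< y → block I x ≡ block I y → f x Fin.< f y

-- Blocks are intervals, so two points of one block are joined by adjacent pairs without a cut, and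
-- the increases along these compose.
adjacent⇒increasing : ∀ (I : Subset m) (f : Fin (suc m) → Fin k) →
                      (∀ i → i ∉ I → f (inject₁ i) Fin.< f (suc i)) → IncreasingOnBlocks I f
adjacent⇒increasing (inside  ∷ I) f adj zero    (suc y) x<y ()
adjacent⇒increasing (outside ∷ I) f adj zero    (suc zero)    x<y eq = adj zero λ ()
adjacent⇒increasing {suc (suc m)} (outside ∷ I) f adj zero (suc (suc y)) x<y eq =
  ℕ.<-trans (adj zero λ ())
    (adjacent⇒increasing I (f ∘ suc) (λ i i∉ → adj (suc i) (i∉ ∘ drop-there)) zero (suc y) z<s eq)
adjacent⇒increasing (inside  ∷ I) f adj (suc x) (suc y) (s≤s x<y) eq =
  adjacent⇒increasing I (f ∘ suc) (λ i i∉ → adj (suc i) (i∉ ∘ drop-there))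
    x y x<y (ℕ.suc-injective eq)
adjacent⇒increasing (outside ∷ I) f adj (suc x) (suc y) (s≤s x<y) eq =
  adjacent⇒increasing I (f ∘ suc) (λ i i∉ → adj (suc i) (i∉ ∘ drop-there)) x y x<y eq

-- Injectivity turns the absence of a descent into a strict increase.
descents⊆⇒increasing : ∀ {I : Subset m} {f : Fin (suc m) → Fin k} → (∀ {x y} → f x ≡ f y → x ≡ y) →
                       descents f ⊆ I → IncreasingOnBlocks I f
descents⊆⇒increasing {I = I} {f} inj D⊆I = adjacent⇒increasing I f λ i i∉I →
  ℕ.≤∧≢⇒< (ℕ.≮⇒≥ (i∉I ∘ D⊆I ∘ ∈-tabulate-does⁺ (descent? f)))
          (ℕ.<⇒≢ (inject₁<suc i) ∘ cong toℕ ∘ inj ∘ Fin.toℕ-injective)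

increasing⇒descents⊆ : ∀ {I : Subset m} {f : Fin (suc m) → Fin k} →
                       IncreasingOnBlocks I f → descents f ⊆ I
increasing⇒descents⊆ {I = I} {f} inc {i} i∈D with i ∈? I
... | yes i∈I = i∈I
... | no  i∉I = contradiction (∈-tabulate-does⁻ (descent? f) i∈D)
  (ℕ.<-asym (inc (inject₁ i) (suc i) (inject₁<suc i) (block-adjacent I i∉I)))

-- Ranking

injective⇒permutation : (f : Fin n → Fin n) → (∀ {i j} → f i ≡ f j → i ≡ j) →
                        ∃ λ (π : Permutation′ n) → ∀ i → π ⟨$⟩ʳ i ≡ f i
injective⇒permutation {n} f inj =
  permutation f (proj₁ ∘ surj) (proj₂ ∘ surj) (λ i → inj (proj₂ (surj (f i)))) , λ _ → refl
  where
  surj : ∀ y → ∃ λ x → f x ≡ y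
  surj y with Fin.any? (λ x → f x Fin.≟ y)
  ... | yes hit  = hit
  -- A value never taken could be assigned to one extra point, which would inject n + 1 points into
  -- n.
  ... | no  miss = contradiction (avoid f inj y λ x eq → miss (x , sym eq)) ℕ.1+n≰n
    where
    avoid : ∀ {l} (f : Fin l → Fin n) → (∀ {i j} → f i ≡ f j → i ≡ j) →
            ∀ y → (∀ x → y ≢ f x) → suc l ≤ n
    avoid {l} f inj y y≢ = Fin.injective⇒≤ {f = extended} extended-injective
      where
      extended : Fin (suc l) → Fin n
      extended zero    = y
      extended (suc x) = f x

      extended-injective : ∀ {i j} → extended i ≡ extended j → i ≡ j
      extended-injective {zero}  {zero}  _  = refl
      extended-injective {zero}  {suc j} eq = contradiction eq (y≢ j)
      extended-injective {suc i} {zero}  eq = contradiction (sym eq) (y≢ i)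
      extended-injective {suc i} {suc j} eq = cong suc (inj eq)

Monotone : (Fin n → ℕ) → Set
Monotone f = ∀ {x y} → x Fin.≤ y → f x ≤ f y

-- If f x exceeded g x, then τ⁻¹ would map the 1 + x points up to x
-- injectively to the x points below x.
monotone-rearrangement-≤ : ∀ {f g : Fin n → ℕ} (τ : Permutation′ n) → Monotone f → Monotone g →
                           (∀ x → f x ≡ g (τ ⟨$⟩ʳ x)) → ∀ x → f x ≤ g x
monotone-rearrangement-≤ {n} {f} {g} τ f-mono g-mono f≡gτ x = ℕ.≮⇒≥ λ gx<fx →
  ℕ.1+n≰n (Fin.injective⇒≤ {f = squeeze gx<fx} λ eq →
    Fin.inject≤-injective _ _ _ _ (injective (flip τ)
      (Fin.toℕ-injective (Fin.fromℕ<-injective _ _ _ _ eq))))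
  where
  upTo : Fin (suc (toℕ x)) → Fin n
  upTo i = Fin.inject≤ i (Fin.toℕ<n x)

  upTo≤ : ∀ i → upTo i Fin.≤ x
  upTo≤ i = subst (_≤ toℕ x) (sym (Fin.toℕ-inject≤ i _)) (ℕ.≤-pred (Fin.toℕ<n i))

  squeeze : g x < f x → Fin (suc (toℕ x)) → Fin (toℕ x)
  squeeze gx<fx i = fromℕ< {toℕ (τ ⟨$⟩ˡ upTo i)} (ℕ.≰⇒> λ x≤ → ℕ.<⇒≱ gx<fx (begin
    f x                               ≤⟨ f-mono x≤ ⟩
    f (τ ⟨$⟩ˡ upTo i)                 ≡⟨ f≡gτ _ ⟩
    g (τ ⟨$⟩ʳ (τ ⟨$⟩ˡ upTo i))        ≡⟨ cong g (inverseʳ τ) ⟩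
    g (upTo i)                        ≤⟨ g-mono (upTo≤ i) ⟩
    g x                               ∎))
    where open ℕ.≤-Reasoning

-- Sorting a multiset has only one outcome: the inequality is used for `τ` and for its inverse.
monotone-rearrangement-≡ : ∀ {f g : Fin n → ℕ} (τ : Permutation′ n) → Monotone f → Monotone g →
                           (∀ x → f x ≡ g (τ ⟨$⟩ʳ x)) → ∀ x → f x ≡ g x
monotone-rearrangement-≡ {f = f} {g} τ f-mono g-mono f≡gτ x = ℕ.≤-antisym
  (monotone-rearrangement-≤ τ f-mono g-mono f≡gτ x)
  (monotone-rearrangement-≤ (flip τ) g-mono f-mono
    (λ y → sym (trans (f≡gτ _) (cong g (inverseʳ τ)))) x)

-- Lexicographic, with the end of a list counting as the largest letter.
_⊏_ : Rel (List ℕ) 0ℓ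
_⊏_ = flip′ (Lex-< _≡_ _>_)

-- The letters are reversed before the lexicographic extension and the whole order after it. Letters
-- thus compare as usual, while the empty list moves from least to greatest.
⊏-isStrictTotalOrder : IsStrictTotalOrder (Pointwise _≡_) _⊏_
⊏-isStrictTotalOrder =
  Flip.isStrictTotalOrder (<-isStrictTotalOrder (Flip.isStrictTotalOrder ℕ.<-isStrictTotalOrder))

module ⊏ = IsStrictTotalOrder ⊏-isStrictTotalOrder

rank : (Fin n → List ℕ) → Fin n → ℕ
rank key j = ∣ Vec.tabulate (does ∘ λ k → key k ⊏.<? key j) ∣

module _ (key : Fin n → List ℕ) where
  private
    below? : ∀ j k → Dec (key k ⊏ key j)
    below? j k = key k ⊏.<? key j

    irrefl : ∀ j → ¬ (key j ⊏ key j)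
    irrefl j = ⊏.irrefl (≡⇒Pointwise-≡ refl)

  -- By transitivity all keys below `key j` are below `key k`, and `j` itself is a new member, so
  -- the inclusion is strict.
  rank-mono : ∀ {j k} → key j ⊏ key k → rank key j < rank key k
  rank-mono {j} {k} j⊏k = p⊂q⇒∣p∣<∣q∣
    ( (λ i∈ → ∈-tabulate-does⁺ (below? k) (⊏.trans (∈-tabulate-does⁻ (below? j) i∈) j⊏k))
    , j , ∈-tabulate-does⁺ (below? k) j⊏k , irrefl j ∘ ∈-tabulate-does⁻ (below? j))

  rank<n : ∀ j → rank key j < n
  rank<n j = subst (rank key j <_) (∣⊤∣≡n n) (p⊂q⇒∣p∣<∣q∣
    ((λ _ → ∈⊤) , j , ∈⊤ , irrefl j ∘ ∈-tabulate-does⁻ (below? j)))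

  ranking : (∀ {j k} → key j ≡ key k → j ≡ k) →
            ∃ λ (π : Permutation′ n) → ∀ {j k} → π ⟨$⟩ʳ j Fin.< π ⟨$⟩ʳ k → key j ⊏ key k
  ranking key-injective = π , reflects
    where
    rank-injective : ∀ {j k} → rank key j ≡ rank key k → j ≡ k
    rank-injective {j} {k} eq with ⊏.compare (key j) (key k)
    ... | tri< j⊏k _ _ = contradiction eq (ℕ.<⇒≢ (rank-mono j⊏k))
    ... | tri≈ _ j≋k _ = key-injective (Pointwise-≡⇒≡ j≋k)
    ... | tri> _ _ k⊏j = contradiction (sym eq) (ℕ.<⇒≢ (rank-mono k⊏j))

    perm = injective⇒permutation (λ j → fromℕ< (rank<n j))
             (rank-injective ∘ Fin.fromℕ<-injective _ _ _ _)
    π = proj₁ perm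

    π≡rank : ∀ j → toℕ (π ⟨$⟩ʳ j) ≡ rank key j
    π≡rank j = trans (cong toℕ (proj₂ perm j)) (Fin.toℕ-fromℕ< (rank<n j))

    reflects : ∀ {j k} → π ⟨$⟩ʳ j Fin.< π ⟨$⟩ʳ k → key j ⊏ key k
    reflects {j} {k} πj<πk with ⊏.compare (key j) (key k)
    ... | tri< j⊏k _ _ = j⊏k
    ... | tri≈ _ j≋k _ = contradiction πj<πk
      (ℕ.<-irrefl (cong (toℕ ∘ (π ⟨$⟩ʳ_)) (key-injective (Pointwise-≡⇒≡ j≋k))))
    ... | tri> _ _ k⊏j = contradiction (rank-mono k⊏j)
      (ℕ.<-asym (subst₂ _<_ (π≡rank j) (π≡rank k) πj<πk))

-- The composite of the inverse of `π` with `ρ` is a monotone rearrangement of the identity, hence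
-- the identity.
same-order⇒≈ : ∀ (π ρ : Permutation′ n) →
               (∀ {j k} → π ⟨$⟩ʳ j Fin.< π ⟨$⟩ʳ k → ρ ⟨$⟩ʳ j Fin.< ρ ⟨$⟩ʳ k) → π ≈ ρ
same-order⇒≈ π ρ mono j = Fin.toℕ-injective (begin
  toℕ (π ⟨$⟩ʳ j)
    ≡⟨ monotone-rearrangement-≡ (flip π ∘ₚ ρ) ρπ⁻¹-mono id (λ _ → refl) (π ⟨$⟩ʳ j) ⟨
  toℕ (ρ ⟨$⟩ʳ (π ⟨$⟩ˡ (π ⟨$⟩ʳ j)))
    ≡⟨ cong (toℕ ∘ (ρ ⟨$⟩ʳ_)) (inverseˡ π) ⟩
  toℕ (ρ ⟨$⟩ʳ j) ∎)
  where
  open ≡-Reasoning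
  ρπ⁻¹-mono : Monotone (λ x → toℕ (ρ ⟨$⟩ʳ (π ⟨$⟩ˡ x)))
  ρπ⁻¹-mono {x} {y} x≤y with ℕ.m≤n⇒m<n∨m≡n x≤y
  ... | inj₁ x<y = ℕ.<⇒≤ (mono (subst₂ Fin._<_ (sym (inverseʳ π)) (sym (inverseʳ π)) x<y))
  ... | inj₂ x≡y = ℕ.≤-reflexive (cong (λ z → toℕ (ρ ⟨$⟩ʳ (π ⟨$⟩ˡ z))) (Fin.toℕ-injective x≡y))

-- rest w j breaks the ties between positions carrying the same letter of w.
module Sorting
  (rest : (Fin n → ℕ) → Fin n → List ℕ)
  (rest-cong : ∀ {w w′} → (∀ j → w j ≡ w′ j) → ∀ j → rest w j ≡ rest w′ j)
  (rest-injective : ∀ w {j k} → rest w j ≡ rest w k → j ≡ k)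
  (B : Fin n → ℕ) (B-mono : Monotone B)
  where

  word : Permutation′ n → Fin n → ℕ
  word t j = B (t ⟨$⟩ʳ j)

  key : (Fin n → ℕ) → Fin n → List ℕ
  key w j = w j ∷ rest w j

  -- Only ties are constrained: as `B` is monotone, positions with different letters are in the
  -- right order anyway.
  Sorted : Permutation′ n → Set
  Sorted t = ∀ {j k} → t ⟨$⟩ʳ j Fin.< t ⟨$⟩ʳ k → word t j ≡ word t k →
             rest (word t) j ⊏ rest (word t) k

  key-cong : ∀ {w w′} → (∀ j → w j ≡ w′ j) → ∀ j → key w j ≡ key w′ j
  key-cong w≡w′ j = cong₂ _∷_ (w≡w′ j) (rest-cong w≡w′ j)

  key-mono : ∀ t → Sorted t → ∀ {j k} → t ⟨$⟩ʳ j Fin.< t ⟨$⟩ʳ k → key (word t) j ⊏ key (word t) k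
  key-mono t sorted tj<tk with ℕ.m≤n⇒m<n∨m≡n (B-mono (ℕ.<⇒≤ tj<tk))
  ... | inj₁ wj<wk = this wj<wk
  ... | inj₂ wj≡wk = next (sym wj≡wk) (sorted tj<tk wj≡wk)

  key-reflects : ∀ t → Sorted t → ∀ {j k} → key (word t) j ⊏ key (word t) k →
                 t ⟨$⟩ʳ j Fin.< t ⟨$⟩ʳ k
  key-reflects t sorted {j} {k} j⊏k with Fin.<-cmp (t ⟨$⟩ʳ j) (t ⟨$⟩ʳ k)
  ... | tri< tj<tk _ _ = tj<tk
  ... | tri≈ _ tj≡tk _ =
    contradiction j⊏k (⊏.irrefl (≡⇒Pointwise-≡ (cong (key (word t)) (injective t tj≡tk))))
  ... | tri> _ _ tk<tj = contradiction j⊏k (⊏.asym (key-mono t sorted tk<tj))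

  -- The keys depend on the word alone, and a sorted permutation orders the positions exactly as
  -- their keys do.
  sorted-unique : ∀ t t′ → (∀ j → word t j ≡ word t′ j) → Sorted t → Sorted t′ → t ≈ t′
  sorted-unique t t′ w≡w′ sorted sorted′ = same-order⇒≈ t t′ λ {j} {k} tj<tk →
    key-reflects t′ sorted′
      (subst₂ _⊏_ (key-cong w≡w′ j) (key-cong w≡w′ k) (key-mono t sorted tj<tk))

  -- The representative is the ranking of the positions by the keys of the word of `t`.
  sorted-exists : ∀ t → ∃ λ t′ → (∀ j → word t j ≡ word t′ j) × Sorted t′
  sorted-exists t = t′ , w≡w′ , sorted
    where
    ranked = ranking (key (word t)) (rest-injective (word t) ∘ ∷-injectiveʳ)
    t′       = proj₁ ranked
    reflects = proj₂ ranked

    heads : ∀ {x y xs ys} → (x ∷ xs) ⊏ (y ∷ ys) → x ≤ y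
    heads (this x<y)   = ℕ.<⇒≤ x<y
    heads (next y≡x _) = ℕ.≤-reflexive (sym y≡x)

    sorted-word : Monotone (λ x → word t (t′ ⟨$⟩ˡ x))
    sorted-word {x} {y} x≤y with ℕ.m≤n⇒m<n∨m≡n x≤y
    ... | inj₁ x<y = heads (reflects (subst₂ Fin._<_ (sym (inverseʳ t′)) (sym (inverseʳ t′)) x<y))
    ... | inj₂ x≡y = ℕ.≤-reflexive (cong (word t ∘ (t′ ⟨$⟩ˡ_)) (Fin.toℕ-injective x≡y))

    -- Read in the order given by `t′`, the letters of `t` form a monotone rearrangement of `B`, and
    -- therefore are `B` itself.
    w≡w′ : ∀ j → word t j ≡ word t′ j
    w≡w′ j = trans (cong (word t) (sym (inverseˡ t′)))
      (monotone-rearrangement-≡ (flip t′ ∘ₚ t) sorted-word B-mono (λ _ → refl) (t′ ⟨$⟩ʳ j))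

    tails⊏ : ∀ {x y xs ys} → (x ∷ xs) ⊏ (y ∷ ys) → x ≡ y → xs ⊏ ys
    tails⊏ (this x<y)      x≡y = contradiction x≡y (ℕ.<⇒≢ x<y)
    tails⊏ (next _ xs⊏ys) _   = xs⊏ys

    sorted : Sorted t′
    sorted {j} {k} t′j<t′k = tails⊏
      (subst₂ _⊏_ (key-cong w≡w′ j) (key-cong w≡w′ k) (reflects t′j<t′k))

-- Transversals and equidistribution

_∼[_]_ : Permutation′ (suc m) → Subset m → Permutation′ (suc m) → Set
t ∼[ I ] t′ = ∀ j → block I (t ⟨$⟩ʳ j) ≡ block I (t′ ⟨$⟩ʳ j)

-- The classes depend on `I` but not on `stat`, which is what makes two statistics comparable class
-- by class.
record Transversal (stat : Permutation′ (suc m) → Subset m) : Set where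
  field
    stat-cong : ∀ {t t′} → t ≈ t′ → stat t ≡ stat t′
    exists    : ∀ I t → ∃ λ t′ → t ∼[ I ] t′ × stat t′ ⊆ I
    unique    : ∀ I t t′ → t ∼[ I ] t′ → stat t ⊆ I → stat t′ ⊆ I → t ≈ t′

-- Having all descents in `I` amounts to increasing on the blocks. Where that agrees with being
-- sorted for some tie-breaking rule, the sorted permutations are the representatives.
transversal : (f : Permutation′ (suc m) → Fin (suc m) → Fin k) →
              (∀ {t t′} → t ≈ t′ → ∀ x → f t x ≡ f t′ x) →
              (∀ t {x y} → f t x ≡ f t y → x ≡ y) →
              (rest : (Fin (suc m) → ℕ) → Fin (suc m) → List ℕ)
              (rest-cong : ∀ {w w′} → (∀ j → w j ≡ w′ j) → ∀ j → rest w j ≡ rest w′ j)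
              (rest-injective : ∀ w {j k} → rest w j ≡ rest w k → j ≡ k) →
              let open Sorting rest rest-cong rest-injective in
              (∀ I t → Sorted (block I) (block-mono I) t → IncreasingOnBlocks I (f t)) →
              (∀ I t → IncreasingOnBlocks I (f t) → Sorted (block I) (block-mono I) t) →
              Transversal (descents ∘ f)
transversal f f-cong f-injective rest rest-cong rest-injective sorted⇒inc inc⇒sorted = record
  { stat-cong = λ {t} {t′} t≈t′ → descents-cong (f-cong {t} {t′} t≈t′)
  ; exists = λ I t → let open Sorting rest rest-cong rest-injective (block I) (block-mono I)
                         t′ , t∼t′ , sorted = sorted-exists t
                     in t′ , t∼t′ , increasing⇒descents⊆ (sorted⇒inc I t′ sorted)
  ; unique = λ I t t′ t∼t′ Dt⊆I Dt′⊆I →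
      let open Sorting rest rest-cong rest-injective (block I) (block-mono I)
      in sorted-unique t t′ t∼t′
           (inc⇒sorted I t (descents⊆⇒increasing (f-injective t) Dt⊆I))
           (inc⇒sorted I t′ (descents⊆⇒increasing (f-injective t′) Dt′⊆I))
  }

equidistribution : {stat stat′ : Permutation′ (suc m) → Subset m} →
                   Transversal stat → Transversal stat′ →
                   ∃ λ (Φ : Inverse (𝒮 (suc m)) (𝒮 (suc m))) → ∀ t → stat′ (Inverse.to Φ t) ≡ stat t
equidistribution {m} {stat} {stat′} T T′ = Φ , λ t →
  trans (proj₂ matching (E.to t)) (T.stat-cong (E.strictlyInverseʳ t))
  where
  module T = Transversal T
  enum = enumeration (suc m)
  N = proj₁ enum
  module E = Inverse (proj₂ enum)

  -- Each permutation counted for `s` is sent to the representative of its class for `s′`; no two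
  -- share a class, by uniqueness for `s`.
  ≤-below : ∀ {s s′} → Transversal s → Transversal s′ →
            ∀ I → below I (tabulate {n = N} (s ∘ E.from)) ≤
                  below I (tabulate {n = N} (s′ ∘ E.from))
  ≤-below {s} {s′} T T′ I = below-≤ (s ∘ E.from) (s′ ∘ E.from) I {λ x y → E.from x ∼[ I ] E.from y}
    (λ x _ → let t′ , x∼t′ , st′⊆I = exists T′ I (E.from x)
                 t′≈ = λ i → sym (E.strictlyInverseʳ t′ i)
             in E.to t′ , subst (_⊆ I) (stat-cong T′ {t′} {E.from (E.to t′)} t′≈) st′⊆I
                        , λ j → trans (x∼t′ j) (cong (block I) (t′≈ j)))
    (λ {x} {x′} sx⊆I sx′⊆I x∼y x′∼y → begin
      x                ≡⟨ E.strictlyInverseˡ x ⟨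
      E.to (E.from x)  ≡⟨ E.to-cong {E.from x} {E.from x′}
                            (unique T I _ _ (λ j → trans (x∼y j) (sym (x′∼y j))) sx⊆I sx′⊆I) ⟩
      E.to (E.from x′) ≡⟨ E.strictlyInverseˡ x′ ⟩
      x′               ∎)
    where
    open Transversal
    open ≡-Reasoning

  matching = tabulate-↭⇒matching (stat ∘ E.from) (stat′ ∘ E.from)
    (below-determines _ _ λ I → ℕ.≤-antisym (≤-below T T′ I) (≤-below T′ T I))

  Φ : Inverse (𝒮 (suc m)) (𝒮 (suc m))
  Φ = inverse (proj₂ enum) (inverse (proj₁ matching) (Symmetry.inverse (proj₂ enum)))

-- The inverse increases on a block when the values of that block occur in `t` from left to right.
-- Ties are therefore broken by position, and a sorted `t` is the standardization of its word.
inverse-transversal : Transversal {m} (λ t → descents (flip t ⟨$⟩ʳ_))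
inverse-transversal {m} = transversal
  (λ t → flip t ⟨$⟩ʳ_) (λ {t} {t′} → flip-cong {π = t} {t′}) (λ t → injective (flip t))
  rest (λ _ _ → refl) (λ _ → Fin.toℕ-injective ∘ ∷-injectiveˡ) sorted⇒inc inc⇒sorted
  where
  rest : (Fin (suc m) → ℕ) → Fin (suc m) → List ℕ
  rest _ j = toℕ j ∷ []

  open Sorting rest (λ _ _ → refl) (λ _ → Fin.toℕ-injective ∘ ∷-injectiveˡ)

  sorted⇒inc : ∀ I t → Sorted (block I) (block-mono I) t → IncreasingOnBlocks I (flip t ⟨$⟩ʳ_)
  sorted⇒inc I t sorted x y x<y eq
    with sorted (subst₂ Fin._<_ (sym (inverseʳ t)) (sym (inverseʳ t)) x<y)
                (subst₂ (λ a b → block I a ≡ block I b) (sym (inverseʳ t)) (sym (inverseʳ t)) eq)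
  ... | this i<j          = i<j
  ... | next _ (base ())

  inc⇒sorted : ∀ I t → IncreasingOnBlocks I (flip t ⟨$⟩ʳ_) → Sorted (block I) (block-mono I) t
  inc⇒sorted I t inc tj<tk eq = this (subst₂ Fin._<_ (inverseˡ t) (inverseˡ t) (inc _ _ tj<tk eq))

-- Full cycles

punchIn-fromℕ : ∀ (i : Fin n) → punchIn (fromℕ n) i ≡ inject₁ i
punchIn-fromℕ zero    = refl
punchIn-fromℕ (suc i) = cong suc (punchIn-fromℕ i)

rotation : Permutation′ (suc n)
rotation {n} = insert (fromℕ n) zero Perm.id

rotation-inject₁ : ∀ (i : Fin n) → rotation ⟨$⟩ʳ inject₁ i ≡ suc i
rotation-inject₁ {n} i = trans (cong (rotation ⟨$⟩ʳ_) (sym (punchIn-fromℕ i)))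
                               (insert-punchIn (fromℕ n) zero Perm.id i)

rotation-fromℕ : ∀ n → rotation ⟨$⟩ʳ fromℕ n ≡ zero
rotation-fromℕ n = insert-self (fromℕ n) zero Perm.id

-- A conjugate of the rotation: find the place of a point in the notation, advance one place
-- cyclically, read the entry there.
cycle : Permutation′ (suc n) → Permutation′ (suc n)
cycle c = flip c ∘ₚ rotation ∘ₚ c

cycle-step : ∀ (c : Permutation′ (suc n)) i → cycle c ⟨$⟩ʳ (c ⟨$⟩ʳ inject₁ i) ≡ c ⟨$⟩ʳ suc i
cycle-step c i = cong (c ⟨$⟩ʳ_) (trans (cong (rotation ⟨$⟩ʳ_) (inverseˡ c)) (rotation-inject₁ i))

cycle-close : ∀ (c : Permutation′ (suc n)) → cycle c ⟨$⟩ʳ (c ⟨$⟩ʳ fromℕ n) ≡ c ⟨$⟩ʳ zero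
cycle-close c = cong (c ⟨$⟩ʳ_) (trans (cong (rotation ⟨$⟩ʳ_) (inverseˡ c)) (rotation-fromℕ _))

cycle-isFullCycle : ∀ (c : Permutation′ (suc n)) → IsFullCycle (cycle c)
cycle-isFullCycle c = record { c = c ; step = cycle-step c ; close = cycle-close c }

cycle-unique : ∀ (π : Permutation′ (suc n)) (cyc : IsFullCycle π) → π ≈ cycle (IsFullCycle.c cyc)
cycle-unique π record { c = c ; step = step ; close = close } x =
  subst (λ y → π ⟨$⟩ʳ y ≡ cycle c ⟨$⟩ʳ y) (inverseʳ c) (at (c ⟨$⟩ˡ x))
  where
  at : ∀ k → π ⟨$⟩ʳ (c ⟨$⟩ʳ k) ≡ cycle c ⟨$⟩ʳ (c ⟨$⟩ʳ k)
  at k with view k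
  ... | ‵fromℕ     = trans close (sym (cycle-close c))
  ... | ‵inject₁ i = trans (step i) (sym (cycle-step c i))

cycle-cong : ∀ (c c′ : Permutation′ (suc n)) → c ≈ c′ → cycle c ≈ cycle c′
cycle-cong c c′ c≈c′ x =
  trans (cong (λ y → c ⟨$⟩ʳ (rotation ⟨$⟩ʳ y)) (flip-cong {π = c} {c′} c≈c′ x)) (c≈c′ _)

-- Once the first entry is fixed, the permutation forces every later one.
notation-unique : ∀ {π π′ : Permutation′ (suc n)} → π ≈ π′ →
                  (cyc : IsFullCycle π) (cyc′ : IsFullCycle π′) →
                  let open IsFullCycle in
                  c cyc ⟨$⟩ʳ zero ≡ c cyc′ ⟨$⟩ʳ zero → c cyc ≈ c cyc′
notation-unique {π = π} {π′} π≈π′ cyc cyc′ c₀≡c′₀ = <-weakInduction _ c₀≡c′₀ λ i ih → begin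
  c cyc ⟨$⟩ʳ suc i                 ≡⟨ step cyc i ⟨
  π ⟨$⟩ʳ (c cyc ⟨$⟩ʳ inject₁ i)    ≡⟨ cong (π ⟨$⟩ʳ_) ih ⟩
  π ⟨$⟩ʳ (c cyc′ ⟨$⟩ʳ inject₁ i)   ≡⟨ π≈π′ _ ⟩
  π′ ⟨$⟩ʳ (c cyc′ ⟨$⟩ʳ inject₁ i)  ≡⟨ step cyc′ i ⟩
  c cyc′ ⟨$⟩ʳ suc i                ∎
  where
  open IsFullCycle
  open ≡-Reasoning

-- Composing the notation with π rotates it by one place.
rotate : {π : Permutation′ (suc n)} → IsFullCycle π → IsFullCycle π
rotate {π = π} cyc = record
  { c     = c ∘ₚ π
  ; step  = λ i → cong (π ⟨$⟩ʳ_) (step i)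
  ; close = cong (π ⟨$⟩ʳ_) close
  }
  where open IsFullCycle cyc

startingAt : {π : Permutation′ (suc n)} → IsFullCycle π → ∀ x →
             ∃ λ (cyc : IsFullCycle π) → IsFullCycle.c cyc ⟨$⟩ʳ zero ≡ x
startingAt {n} {π} cyc x = reach (IsFullCycle.c cyc ⟨$⟩ˡ x) cyc (inverseʳ (IsFullCycle.c cyc))
  where
  -- Quantified over all notations because the induction replaces the notation by its rotation,
  -- which moves `x` one place towards the front.
  Reachable : Fin (suc n) → Set
  Reachable k = (cyc : IsFullCycle π) → IsFullCycle.c cyc ⟨$⟩ʳ k ≡ x →
                ∃ λ (cyc′ : IsFullCycle π) → IsFullCycle.c cyc′ ⟨$⟩ʳ zero ≡ x

  reach : ∀ k → Reachable k
  reach = <-weakInduction Reachable (λ cyc eq → cyc , eq)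
    (λ i ih cyc eq → ih (rotate cyc) (trans (IsFullCycle.step cyc i) eq))

withTop : Permutation′ n → Permutation′ (suc n)
withTop {n} t = insert zero (fromℕ n) t

withTop-suc : ∀ (t : Permutation′ n) j → withTop t ⟨$⟩ʳ suc j ≡ inject₁ (t ⟨$⟩ʳ j)
withTop-suc {n} t j = trans (insert-punchIn zero (fromℕ n) t j) (punchIn-fromℕ _)

topCycle : Permutation′ n → Permutation′ (suc n)
topCycle t = cycle (withTop t)

topCycle-inject₁ : ∀ (t : Permutation′ (suc n)) i →
                   topCycle t ⟨$⟩ʳ inject₁ (t ⟨$⟩ʳ inject₁ i) ≡ inject₁ (t ⟨$⟩ʳ suc i)
topCycle-inject₁ t i = begin
  topCycle t ⟨$⟩ʳ inject₁ (t ⟨$⟩ʳ inject₁ i)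
    ≡⟨ cong (topCycle t ⟨$⟩ʳ_) (withTop-suc t (inject₁ i)) ⟨
  topCycle t ⟨$⟩ʳ (withTop t ⟨$⟩ʳ suc (inject₁ i))
    ≡⟨ cycle-step (withTop t) (suc i) ⟩
  withTop t ⟨$⟩ʳ suc (suc i)
    ≡⟨ withTop-suc t (suc i) ⟩
  inject₁ (t ⟨$⟩ʳ suc i) ∎
  where open ≡-Reasoning

-- The notation closes up at the top point. This largest value is why the end of a word counts as
-- the largest letter.
topCycle-fromℕ : ∀ (t : Permutation′ (suc n)) →
                 topCycle t ⟨$⟩ʳ inject₁ (t ⟨$⟩ʳ fromℕ n) ≡ fromℕ (suc n)
topCycle-fromℕ {n} t = trans (cong (topCycle t ⟨$⟩ʳ_) (sym (withTop-suc t (fromℕ n))))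
                             (cycle-close (withTop t))

topCycle-cong : {t t′ : Permutation′ n} → t ≈ t′ → topCycle t ≈ topCycle t′
topCycle-cong {n} {t} {t′} t≈t′ =
  cycle-cong (withTop t) (withTop t′) (insert-cong zero (fromℕ n) {t} {t′} t≈t′)

-- Cycles and the suffix order

-- Begins just after the given position, since `key` puts the letter at that position in front.
suffix : (Fin n → ℕ) → Fin n → List ℕ
suffix w zero    = tabulate (w ∘ suc)
suffix w (suc j) = suffix (w ∘ suc) j

suffix-cong : ∀ {w w′ : Fin n → ℕ} → (∀ j → w j ≡ w′ j) → ∀ j → suffix w j ≡ suffix w′ j
suffix-cong w≡w′ zero    = tabulate-cong (w≡w′ ∘ suc)
suffix-cong w≡w′ (suc j) = suffix-cong (w≡w′ ∘ suc) j

length-suffix : ∀ (w : Fin n → ℕ) j → suc (toℕ j) + length (suffix w j) ≡ n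
length-suffix w zero    = cong suc (length-tabulate (w ∘ suc))
length-suffix w (suc j) = cong suc (length-suffix (w ∘ suc) j)

-- Suffixes at different positions differ in length.
suffix-injective : ∀ (w : Fin n → ℕ) {j k} → suffix w j ≡ suffix w k → j ≡ k
suffix-injective {n} w {j} {k} eq = Fin.toℕ-injective (ℕ.suc-injective
  (ℕ.+-cancelʳ-≡ (length (suffix w j)) _ _ (begin
    suc (toℕ j) + length (suffix w j) ≡⟨ length-suffix w j ⟩
    n                                 ≡⟨ length-suffix w k ⟨
    suc (toℕ k) + length (suffix w k) ≡⟨ cong (λ l → suc (toℕ k) + length l) eq ⟨
    suc (toℕ k) + length (suffix w j) ∎)))
  where open ≡-Reasoning

suffix-fromℕ : ∀ (w : Fin (suc n) → ℕ) → suffix w (fromℕ n) ≡ []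
suffix-fromℕ {zero}  w = refl
suffix-fromℕ {suc n} w = suffix-fromℕ (w ∘ suc)

suffix-inject₁ : ∀ (w : Fin (suc n) → ℕ) i → suffix w (inject₁ i) ≡ w (suc i) ∷ suffix w (suc i)
suffix-inject₁ w zero    = refl
suffix-inject₁ w (suc i) = suffix-inject₁ (w ∘ suc) i

-- The cycle sends each entry of `t` to the next one. Comparing its values at two points of a block
-- thus compares `t` one position later, and for a sorted `t` this compares the suffixes after the
-- two positions.
topCycle-transversal : Transversal {m} (λ t → descents (λ x → topCycle t ⟨$⟩ʳ inject₁ x))
topCycle-transversal {m} = transversal next-value
  (λ {t} {t′} t≈t′ x → topCycle-cong {t = t} {t′} t≈t′ (inject₁ x))
  (λ t → Fin.inject₁-injective ∘ injective (topCycle t))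
  suffix suffix-cong suffix-injective sorted⇒inc inc⇒sorted
  where
  open Sorting suffix suffix-cong suffix-injective

  next-value : Permutation′ (suc m) → Fin (suc m) → Fin (suc (suc m))
  next-value t x = topCycle t ⟨$⟩ʳ inject₁ x

  inject₁-mono-< : ∀ {x y : Fin n} → x Fin.< y → inject₁ x Fin.< inject₁ y
  inject₁-mono-< = subst₂ _<_ (sym (Fin.toℕ-inject₁ _)) (sym (Fin.toℕ-inject₁ _))

  inject₁-cancel-< : ∀ {x y : Fin n} → inject₁ x Fin.< inject₁ y → x Fin.< y
  inject₁-cancel-< = subst₂ _<_ (Fin.toℕ-inject₁ _) (Fin.toℕ-inject₁ _)

  inject₁<fromℕ : ∀ (x : Fin n) → inject₁ x Fin.< fromℕ n
  inject₁<fromℕ x = subst₂ _<_ (sym (Fin.toℕ-inject₁ x)) (sym (Fin.toℕ-fromℕ _)) (Fin.toℕ<n x)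

  letters : Subset m → Permutation′ (suc m) → Fin (suc m) → ℕ
  letters I = word (block I) (block-mono I)

  sorted⇒step : ∀ I t → Sorted (block I) (block-mono I) t →
                ∀ j k → suffix (letters I t) j ⊏ suffix (letters I t) k →
                next-value t (t ⟨$⟩ʳ j) Fin.< next-value t (t ⟨$⟩ʳ k)
  sorted⇒step I t sorted j k j⊏k with view j | view k
  -- The last position has the empty suffix, and nothing lies above that.
  ... | ‵fromℕ | _ =
    contradiction (subst (_⊏ suffix (letters I t) k) (suffix-fromℕ (letters I t)) j⊏k) xs≮[]
  ... | ‵inject₁ i | ‵fromℕ =
    subst₂ Fin._<_ (sym (topCycle-inject₁ t i)) (sym (topCycle-fromℕ t)) (inject₁<fromℕ _)
  ... | ‵inject₁ i | ‵inject₁ l =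
    subst₂ Fin._<_ (sym (topCycle-inject₁ t i)) (sym (topCycle-inject₁ t l))
      (inject₁-mono-< (key-reflects (block I) (block-mono I) t sorted
        (subst₂ _⊏_ (suffix-inject₁ _ i) (suffix-inject₁ _ l) j⊏k)))

  sorted⇒inc : ∀ I t → Sorted (block I) (block-mono I) t → IncreasingOnBlocks I (next-value t)
  sorted⇒inc I t sorted x y x<y eq =
    subst₂ (λ a b → next-value t a Fin.< next-value t b) (inverseʳ t) (inverseʳ t)
      (sorted⇒step I t sorted (t ⟨$⟩ˡ x) (t ⟨$⟩ˡ y)
        (sorted (subst₂ Fin._<_ (sym (inverseʳ t)) (sym (inverseʳ t)) x<y)
                (subst₂ (λ a b → block I a ≡ block I b) (sym (inverseʳ t)) (sym (inverseʳ t)) eq)))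

  inc⇒sorted : ∀ I t → IncreasingOnBlocks I (next-value t) → Sorted (block I) (block-mono I) t
  -- The induction runs backwards from the end of the word, since a suffix is compared through the
  -- later suffix that it contains.
  inc⇒sorted I t inc {j} {k} tj<tk eq = >-weakInduction SortedAt last before j k tj<tk eq
    where
    w = letters I t

    SortedAt : Fin (suc m) → Set
    SortedAt j = ∀ k → t ⟨$⟩ʳ j Fin.< t ⟨$⟩ʳ k → w j ≡ w k → suffix w j ⊏ suffix w k

    -- The last entry is sent to the top point, so no other point of its block can have a larger
    -- image.
    last : SortedAt (fromℕ m)
    last k tj<tk eq = contradiction
      (subst (Fin._< next-value t (t ⟨$⟩ʳ k)) (topCycle-fromℕ t) (inc _ _ tj<tk eq))
      (ℕ.≤⇒≯ (Fin.≤fromℕ (next-value t (t ⟨$⟩ʳ k))))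

    before : ∀ i → SortedAt (suc i) → SortedAt (inject₁ i)
    before i ih k tj<tk eq with view k
    ... | ‵fromℕ     = subst₂ _⊏_ (sym (suffix-inject₁ w i)) (sym (suffix-fromℕ w)) halt
    ... | ‵inject₁ l = subst₂ _⊏_ (sym (suffix-inject₁ w i)) (sym (suffix-inject₁ w l)) tails⊏
      where
      t₊ : t ⟨$⟩ʳ suc i Fin.< t ⟨$⟩ʳ suc l
      t₊ = inject₁-cancel-<
        (subst₂ Fin._<_ (topCycle-inject₁ t i) (topCycle-inject₁ t l) (inc _ _ tj<tk eq))

      tails⊏ : (w (suc i) ∷ suffix w (suc i)) ⊏ (w (suc l) ∷ suffix w (suc l))
      -- The next entries are in order, so their letters are weakly in order; a tie is passed on to
      -- the induction hypothesis.
      tails⊏ with ℕ.m≤n⇒m<n∨m≡n (block-mono I (ℕ.<⇒≤ t₊))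
      ... | inj₁ w<w′ = this w<w′
      ... | inj₂ w≡w′ = next (sym w≡w′) (ih (suc l) t₊ w≡w′)

-- The bijection

-- The notation is rotated until it starts with the top point, which is then deleted. The result
-- does not depend on the witness, because the first entry determines the notation.
𝒞↔𝒮 : ∀ n → Inverse (𝒞 (suc n)) (𝒮 n)
𝒞↔𝒮 n = record
  { to        = to
  ; from      = from
  ; to-cong   = λ {x} {y} → to-cong {x} {y}
  ; from-cong = λ {t} {t′} → topCycle-cong {t = t} {t′}
  ; inverse   = (λ {t} {x} x≈ → λ i → trans (to-cong {x} {from t} x≈ i) (to-from t i))
              , (λ {x} {t} t≈ → λ i → trans (topCycle-cong {t = t} {to x} t≈ i) (from-to x i))
  }
  where
  open IsFullCycle
  ∣𝒞∣ = ∃ (IsFullCycle {n})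

  topped : (x : ∣𝒞∣) → ∃ λ (cyc : IsFullCycle (proj₁ x)) → c cyc ⟨$⟩ʳ zero ≡ fromℕ n
  topped (_ , cyc) = startingAt cyc (fromℕ n)

  c⊤ : ∣𝒞∣ → Permutation′ (suc n)
  c⊤ x = c (proj₁ (topped x))

  c⊤-zero : ∀ x → c⊤ x ⟨$⟩ʳ zero ≡ fromℕ n
  c⊤-zero x = proj₂ (topped x)

  to : ∣𝒞∣ → Permutation′ n
  to x = remove zero (c⊤ x)

  from : Permutation′ n → ∣𝒞∣
  from t = topCycle t , cycle-isFullCycle (withTop t)

  to-cong : ∀ {x y : ∣𝒞∣} → proj₁ x ≈ proj₁ y → to x ≈ to y
  to-cong {x} {y} x≈y = remove-cong zero {c⊤ x} {c⊤ y}
    (notation-unique {π = proj₁ x} {proj₁ y} x≈y (proj₁ (topped x)) (proj₁ (topped y))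
      (trans (c⊤-zero x) (sym (c⊤-zero y))))

  to-from : ∀ t → to (from t) ≈ t
  to-from t i = trans
    (remove-cong zero {c⊤ (from t)} {withTop t}
      (notation-unique {π = topCycle t} {topCycle t} (λ _ → refl)
        (proj₁ (topped (from t))) (cycle-isFullCycle (withTop t)) (c⊤-zero (from t))) i)
    (remove-insert zero (fromℕ n) t i)

  withTop-to : ∀ x → withTop (to x) ≈ c⊤ x
  withTop-to x j = trans (cong (λ k → insert zero k (to x) ⟨$⟩ʳ j) (sym (c⊤-zero x)))
                         (insert-remove zero (c⊤ x) j)

  from-to : ∀ x → topCycle (to x) ≈ proj₁ x
  from-to x i = trans (cycle-cong (withTop (to x)) (c⊤ x) (withTop-to x) i)
                      (sym (cycle-unique (proj₁ x) (proj₁ (topped x)) i))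

flip-inverse : ∀ n → Inverse (𝒮 n) (𝒮 n)
flip-inverse n = record
  { to        = flip
  ; from      = flip
  ; to-cong   = λ {π} {ρ} → flip-cong {π = π} {ρ}
  ; from-cong = λ {π} {ρ} → flip-cong {π = π} {ρ}
  -- Flipping twice computes to the original permutation, so both inverse laws are instances of
  -- congruence.
  ; inverse   = (λ {π} {ρ} → flip-cong {π = ρ} {flip π}) , (λ {π} {ρ} → flip-cong {π = ρ} {flip π})
  }

successive : ∀ (x y : Fin (suc m)) → toℕ y ≡ suc (toℕ x) → ∃ λ k → x ≡ inject₁ k × y ≡ suc k
successive x (suc k) eq =
  k , Fin.toℕ-injective (trans (ℕ.suc-injective (sym eq)) (sym (Fin.toℕ-inject₁ k))) , refl

labels : Subset m → Pred ℕ 0ℓ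
labels S i = ∃ λ k → label k ≡ i × k ∈ S

D≐descents : ∀ (σ : Permutation′ (suc m)) → D σ ≐ labels (descents (σ ⟨$⟩ʳ_))
D≐descents σ = to , from
  where
  to : ∀ {i} → D σ i → labels (descents (σ ⟨$⟩ʳ_)) i
  to (x , y , refl , y≡x+2 , σy<σx) with k , refl , refl ← successive x y (ℕ.suc-injective y≡x+2) =
    k , cong suc (sym (Fin.toℕ-inject₁ k)) , ∈-tabulate-does⁺ (descent? (σ ⟨$⟩ʳ_)) σy<σx

  from : ∀ {i} → labels (descents (σ ⟨$⟩ʳ_)) i → D σ i
  from (k , refl , k∈) =
    inject₁ k , suc k , cong suc (Fin.toℕ-inject₁ k) , refl ,
    ∈-tabulate-does⁻ (descent? (σ ⟨$⟩ʳ_)) k∈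

-- The intersection discards only label m + 1, the one comparison in which the top point is an
-- argument.
D∩≐descents : ∀ (π : Permutation′ (suc (suc m))) →
              D π ∩ [ m ] ≐ labels (descents (λ x → π ⟨$⟩ʳ inject₁ x))
D∩≐descents {m} π = to , from
  where
  f : Fin (suc m) → Fin (suc (suc m))
  f x = π ⟨$⟩ʳ inject₁ x

  to : ∀ {i} → (D π ∩ [ m ]) i → labels (descents f) i
  to {i} (Dπi , _ , i≤m) with proj₁ (D≐descents π) Dπi
  ... | k , refl , k∈ with view k
  ...   | ‵fromℕ     = contradiction (subst (λ l → suc l ≤ m) (Fin.toℕ-fromℕ m) i≤m) ℕ.1+n≰n
  -- Both sides compare the same two points, since `inject₁` commutes with `suc` by computation.
  ...   | ‵inject₁ l = l , cong suc (sym (Fin.toℕ-inject₁ l))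
                     , ∈-tabulate-does⁺ (descent? f) (∈-tabulate-does⁻ (descent? (π ⟨$⟩ʳ_)) k∈)

  from : ∀ {i} → labels (descents f) i → (D π ∩ [ m ]) i
  from (l , refl , l∈) =
    proj₂ (D≐descents π) (inject₁ l , cong suc (Fin.toℕ-inject₁ l)
      , ∈-tabulate-does⁺ (descent? (π ⟨$⟩ʳ_)) (∈-tabulate-does⁻ (descent? f) l∈))
    , s≤s z≤n , Fin.toℕ<n l

theorem2p1 : (n : ℕ) .{{_ : NonZero n}} →
    Σ (Bijection (𝒞 (suc n)) (𝒮 n)) λ φ →
    ∀ π (cyc : IsFullCycle π) →
    D π ∩ [ n ∸ 1 ] ≐ D (Bijection.to φ (π , cyc))
-- A cycle is read as `t`, matched with `Φ t`, and inverted at the end because the second statistic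
-- is the descent set of the inverse.
theorem2p1 (suc m) = Inverse⇒Bijection (inverse (𝒞↔𝒮 (suc m)) (inverse Φ (flip-inverse (suc m)))) ,
  λ π cyc → let t = to (π , cyc) in
    ≐-trans (D∩≐descents π)
      (subst (λ S → labels S ≐ D (flip (Inverse.to Φ t)))
        -- `preserves` speaks of the cycle rebuilt from `t`; the round trip identifies it with `π`.
        (trans (preserves t) (descents-cong (strictlyInverseʳ (π , cyc) ∘ inject₁)))
        (≐-sym (D≐descents (flip (Inverse.to Φ t)))))
  where
  open Inverse (𝒞↔𝒮 (suc m)) using (to; strictlyInverseʳ)
  open Σ (equidistribution topCycle-transversal inverse-transversal)
    renaming (proj₁ to Φ; proj₂ to preserves)
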